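{- Let $I\subseteq\{\sqsubseteq,\sqsupseteq,\leftrightarrows,\hookleftarrow\}$ and let $\mathcal Y$, $\mathcal Z$ be HDAs over $\Sigma$. Then $\mathcal Y$ and $\mathcal Z$ are $I$-bisimilar if and only if they satisfy the same formulas of $\mathcal L_I$. In particular ($I=\{\sqsubseteq,\sqsupseteq,\leftrightarrows,\hookleftarrow\}$), two HDAs are hereditary history-preserving (hhp-) bisimilar if and only if they satisfy the same formulas generated by $$F::=\top\mid\lnot F\mid\bigwedge_{j\in J}F_j\mid\Lambda m\mid\langle\hookrightarrow\rangle F\mid\langle\sqsubseteq^\ell\rangle F\mid\langle\sqsupseteq^\ell\rangle F\mid\langle\leftrightarrows^\ell\rangle F\mid\langle\hookleftarrow\rangle F .$$
   Context: HDAs. $\Sigma$ is a fixed set of actions. A conclist is $U=(n,\lambda)$ with $n\in\mathbb N$ and $\lambda:\{1<\dots<n\}\to\Sigma$. The category $\square$ has conclists as objects; a morphism $(m,\lambda)\to(n,\mu)$ is a pair $(f,\varepsilon)$ with $f:\{1,\dots,m\}\to\{1,\dots,n\}$ injective, order- and label-preserving, and $\varepsilon:\{1,\dots,n\}\to\{0,*,1\}$ with $\varepsilon^{ -1}(*)=\mathrm{im} f$; composition is $(g,\zeta)\circ(f,\varepsilon)=(g\circ f,\eta)$ with $\eta(g(t))=\varepsilon(t)$ and $\eta(u)=\zeta(u)$ for $u\notin\mathrm{im}\,g$. For $1\le i\le n$, $k\in\{0,1\}$, the coface map $d_i^k:U\to V$ ($V$ of dimension $n$, $U$ of dimension $n-1$)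 has $f$ omitting position $i$, $\varepsilon(i)=k$, and $\varepsilon(j)=*$ for $j\ne i$. A precubical set is a functor $X:\square^{op}\to\mathbf{Set}$; elements of $X[U]$, $U=(n,\lambda)$, are $n$-dimensional cells, and $\delta_i^k:=X[d_i^k]$. An HDA is a pair $(X,i)$ of a precubical set and an initial $0$-dimensional cell $i$. Paths. A path of an HDA $\mathcal X$ is a sequence $\alpha=(x_0,\varphi_1,x_1,\dots,\varphi_n,x_n)$ ($n\ge 0$) with $x_0$ the initial cell, $x_j\in X[U_j]$, where for each $j$ either $\varphi_j=d^0_{i_j}:U_{j-1}\to U_j$ with $x_{j-1}=\delta^0_{i_j}(x_j)$ (up-step, starting an event) or $\varphi_j=d^1_{i_j}:U_j\to U_{j-1}$ with $x_j=\delta^1_{i_j}(x_{j-1})$ (down-step, ending an event). $\mathrm{Path}_{\mathcal X}$ is the set of paths. $\alpha\hookrightarrow\alpha'$ (equivalently $\alpha'\hookleftarrow\alpha$) means $\alpha$ is a prefix of $\alpha'$. $\alpha\leftrightarrows^\ell\beta$ ($\ell$-similarity): one of $\alpha,\beta$ is obtained from the other by replacing, around the cell $x_\ell$, $(d_i^0,x_\ell,d_j^0)$ by $(d_{j-1}^0,x'_\ell,d_i^0)$, or $(d_j^1,x_\ell,d_i^1)$ by $(d_i^1,x'_\ell,d_{j-1}^1)$, for some $i<j$ and some cell $x'_\ell$. $\alpha\sqsubseteq^\ell\beta$ ($\beta$ subsumes $\alpha$ at $\ell$; also written $\beta\sqsupseteq^\ell\alpha$): $\alpha$ is obtained from $\beta$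 by replacing, around $x_\ell$, $(d_i^0,x_\ell,d_j^1)$ by $(d_{j-1}^1,x'_\ell,d_i^0)$, or $(d_j^0,x_\ell,d_i^1)$ by $(d_i^1,x'_\ell,d_{j-1}^0)$, for some $i<j$. ST-traces. Given a down-step at position $p$ of a path, move it to the left: as long as the step directly before it is a down-step, or an up-step whose index differs from the current index of the moving down-step, there is a unique replacement moving it one position left: for some $i<j$ and cells $x,x'$, it replaces $(d_j^1,x,d_i^1)$ by $(d_i^1,x',d_{j-1}^1)$ or conversely (if the step directly before is a down-step), or it replaces $(d_i^0,x,d_j^1)$ by $(d_{j-1}^1,x',d_i^0)$ or $(d_j^0,x,d_i^1)$ by $(d_i^1,x',d_{j-1}^0)$ (if the step directly before is an up-step). This stops when the step directly before it, at position $k$, is an up-step with the same index; put $\mathrm{start}(p)=k$. $\mathsf{ST}(\alpha)$ is the sequence whose $j$-th entry is $a^+$ if $\varphi_j$ is an up-step starting an event labelled $a$ (the label of the $i_j$-th event of $U_j$), and $a^{\mathrm{start}(j)}$ if $\varphi_j$ is a down-step ending an event labelled $a$ (the label of the $i_j$-th event of $U_{j-1}$). $I$-bisimulations. For $I\subseteq\{\sqsubseteq,\sqsupseteq,\leftrightarrows,\hookleftarrow\}$, an $I$-bisimulation between HDAs $\mathcal Y,\mathcal Z$ is a relation $\mathfrak R$ between paths of $\mathcal Y$ and of $\mathcal Z$ satisfying the following clauses, each also with the roles of $\mathcal Y$ and $\mathcal Z$ exchanged: (1) the length-$0$ paths of $\mathcal Y$ and $\mathcal Z$ are related; (2) if $(\alpha,\beta)\in\mathfrak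 R$ then $\mathsf{ST}(\alpha)=\mathsf{ST}(\beta)$; (3) if $(\alpha,\beta)\in\mathfrak R$ and $\alpha\hookrightarrow\alpha'$, there is $\beta'$ with $\beta\hookrightarrow\beta'$ and $(\alpha',\beta')\in\mathfrak R$; and those of the following whose symbol lies in $I$: ($\sqsubseteq$) if $(\alpha,\beta)\in\mathfrak R$ and $\alpha\sqsubseteq^\ell\alpha'$, there is $\beta'$ with $\beta\sqsubseteq^\ell\beta'$, $(\alpha',\beta')\in\mathfrak R$; ($\sqsupseteq$) the same with $\alpha'\sqsubseteq^\ell\alpha$ and $\beta'\sqsubseteq^\ell\beta$; ($\leftrightarrows$) the same with $\alpha'\leftrightarrows^\ell\alpha$ and $\beta'\leftrightarrows^\ell\beta$; ($\hookleftarrow$) the same with $\alpha'\hookrightarrow\alpha$ and $\beta'\hookrightarrow\beta$. $\mathcal Y,\mathcal Z$ are $I$-bisimilar if an $I$-bisimulation between them exists. hhp-bisimilarity is $\{\sqsubseteq,\sqsupseteq,\leftrightarrows,\hookleftarrow\}$-bisimilarity. Logic. $\mathcal L_I$ is generated by $\top$, negation $\lnot F$, conjunctions $\bigwedge_{j\in J}F_j$ over arbitrary index sets $J$, $\Lambda m$ for $m$ an ST-trace, $\langle\hookrightarrow\rangle F$, and, for the symbols in $I$, $\langle\sqsubseteq^\ell\rangle F$, $\langle\sqsupseteq^\ell\rangle F$, $\langle\leftrightarrows^\ell\rangle F$ (all $\ell\in\mathbb N$) and $\langle\hookleftarrow\rangle F$, respectively. Satisfaction for a path $\alpha$ of an HDA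 $\mathcal X$: Boolean connectives as usual; $\alpha\models\Lambda m$ iff $\mathsf{ST}(\alpha)=m$; $\alpha\models\langle\ltimes\rangle F$ iff there is a path $\beta$ of $\mathcal X$ with $\alpha\ltimes\beta$ and $\beta\models F$. An HDA satisfies $F$ iff its length-$0$ path does. -}

module Defs where

open import Level using (Level; 0ℓ) renaming (suc to lsuc)
open import Data.Nat using (ℕ; zero; suc; z≤n; s≤s)
open import Data.Fin using (Fin; zero; suc; _≤_; inject₁; punchIn; punchOut)
open import Data.Fin.Properties
  using (_≟_; any?; punchIn-injective; punchInᵢ≢i; punchIn-mono-≤; punchIn-punchOut)
open import Data.Vec using (Vec; []; _∷_; lookup; removeAt)
open import Data.List using (List; []; _∷ʳ_)
open import Data.Product using (∃; ∃-syntax; _×_; _,_; proj₁; proj₂)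
open import Data.Sum using (_⊎_; inj₁; inj₂)
open import Data.Unit.Polymorphic using (⊤)
open import Function using (_∘_; flip; id; _⇔_; mk⇔; Equivalence)
open import Function.Definitions using (Injective)
open import Relation.Nullary using (¬_; yes; no; contradiction)
open import Relation.Unary using (Pred; _∈_; U)
open import Relation.Binary using (REL)
open import Relation.Binary.PropositionalEquality
  using (_≡_; _≢_; refl; sym; trans; cong; cong₂; subst)

private
  variable
    a : Level
    Act : Set a

------------------------------------------------------------------------
-- Conclists and the category □

-- Labellings are vectors rather than functions, so that two conclists
-- with the same labels are propositionally equal.
Conclist : Set a → Set a
Conclist Act = ∃ λ n → Vec Act n

dim : Conclist Act → ℕ
dim = proj₁

label : (V : Conclist Act) → Fin (dim V) → Act
label V = lookup (proj₂ V)

data Side : Set where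
  𝟎 𝟏 : Side

-- The set {0, *, 1}.
data Value : Set where
  ✱  : Value
  at : Side → Value

record Hom {Act : Set a} (V W : Conclist Act) : Set a where
  field
    f         : Fin (dim V) → Fin (dim W)
    ε         : Fin (dim W) → Value
    injective : Injective _≡_ _≡_ f
    monotone  : ∀ {s t} → s ≤ t → f s ≤ f t
    labels    : ∀ t → label W (f t) ≡ label V t
    ✱⇔image   : ∀ u → ε u ≡ ✱ ⇔ (∃[ t ] f t ≡ u)

-- Hom contains proofs; morphisms are compared as pairs (f , ε).
record _≈_ {Act : Set a} {V W : Conclist Act} (φ ψ : Hom V W) : Set where
  constructor _,_
  field
    f-≗ : ∀ t → Hom.f φ t ≡ Hom.f ψ t
    ε-≗ : ∀ u → Hom.ε φ u ≡ Hom.ε ψ u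

id□ : (V : Conclist Act) → Hom V V
id□ V = record
  { f         = id
  ; ε         = λ _ → ✱
  ; injective = id
  ; monotone  = id
  ; labels    = λ _ → refl
  ; ✱⇔image   = λ u → mk⇔ (λ _ → u , refl) (λ _ → refl)
  }

composeValue : ∀ {m n} → (Fin m → Fin n) → (Fin n → Value) → (Fin m → Value) → Fin n → Value
composeValue g ζ ε u with any? (λ t → g t ≟ u)
... | yes (t , _) = ε t
... | no _        = ζ u

infixr 9 _∘□_

_∘□_ : {V W Z : Conclist Act} → Hom W Z → Hom V W → Hom V Z
_∘□_ {V = V} {W} {Z} ψ φ = record
  { f         = ψ.f ∘ φ.f
  ; ε         = composeValue ψ.f ψ.ε φ.ε
  ; injective = φ.injective ∘ ψ.injective
  ; monotone  = ψ.monotone ∘ φ.monotone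
  ; labels    = λ t → trans (ψ.labels (φ.f t)) (φ.labels t)
  ; ✱⇔image   = λ u → mk⇔ (to u) (from u)
  }
  where
  module φ = Hom φ
  module ψ = Hom ψ

  to : ∀ u → composeValue ψ.f ψ.ε φ.ε u ≡ ✱ → ∃[ t ] ψ.f (φ.f t) ≡ u
  to u eq with any? (λ t → ψ.f t ≟ u)
  ... | yes (t , ψt≡u) =
        let s , φs≡t = Equivalence.to (φ.✱⇔image t) eq
        in  s , trans (cong ψ.f φs≡t) ψt≡u
  ... | no ∄t = contradiction (Equivalence.to (ψ.✱⇔image u) eq) ∄t

  from : ∀ u → (∃[ t ] ψ.f (φ.f t) ≡ u) → composeValue ψ.f ψ.ε φ.ε u ≡ ✱
  from u (s , ψφs≡u) with any? (λ t → ψ.f t ≟ u)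
  ... | yes (t , ψt≡u) =
        Equivalence.from (φ.✱⇔image t) (s , ψ.injective (trans ψφs≡u (sym ψt≡u)))
  ... | no ∄t = contradiction (φ.f s , ψφs≡u) ∄t

cofaceValue : ∀ {n} → Side → Fin n → Fin n → Value
cofaceValue k i u with u ≟ i
... | yes _ = at k
... | no _  = ✱

lookup-punchIn : ∀ {A : Set a} {n} (v : Vec A (suc n)) i t →
                 lookup v (punchIn i t) ≡ lookup (removeAt v i) t
lookup-punchIn (x ∷ v)     zero    t       = refl
lookup-punchIn (x ∷ y ∷ v) (suc i) zero    = refl
lookup-punchIn (x ∷ y ∷ v) (suc i) (suc t) = lookup-punchIn (y ∷ v) i t

-- The coface map d_i^k into (n+1 , v).  Its source is determined by i:
-- preservation of labels forces it to be v with the i-th entry removed.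
d : ∀ {n} (k : Side) (i : Fin (suc n)) (v : Vec Act (suc n)) →
    Hom (n , removeAt v i) (suc n , v)
d k i v = record
  { f         = punchIn i
  ; ε         = cofaceValue k i
  ; injective = punchIn-injective i _ _
  ; monotone  = punchIn-mono-≤ i _ _
  ; labels    = lookup-punchIn v i
  ; ✱⇔image   = λ u → mk⇔ (to u) (from u)
  }
  where
  to : ∀ u → cofaceValue k i u ≡ ✱ → ∃[ t ] punchIn i t ≡ u
  to u eq with u ≟ i
  to u () | yes _
  ... | no u≢i = punchOut (u≢i ∘ sym) , punchIn-punchOut (u≢i ∘ sym)

  from : ∀ u → (∃[ t ] punchIn i t ≡ u) → cofaceValue k i u ≡ ✱
  from u (t , it≡u) with u ≟ i
  ... | yes u≡i = contradiction (trans it≡u u≡i) (punchInᵢ≢i i t)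
  ... | no _    = refl

------------------------------------------------------------------------
-- Precubical sets and higher-dimensional automata

record PrecubicalSet (Act : Set a) : Set (lsuc a) where
  field
    X₀     : Conclist Act → Set a
    X₁     : ∀ {V W} → Hom V W → X₀ W → X₀ V
    X-resp : ∀ {V W} {φ ψ : Hom V W} → φ ≈ ψ → ∀ x → X₁ φ x ≡ X₁ ψ x
    X-id   : ∀ {V} (x : X₀ V) → X₁ (id□ V) x ≡ x
    X-∘    : ∀ {V W Z} (ψ : Hom W Z) (φ : Hom V W) x → X₁ (ψ ∘□ φ) x ≡ X₁ φ (X₁ ψ x)

  -- n-dimensional cells, of all conclists of dimension n.
  Cell : ℕ → Set a
  Cell n = ∃ λ (v : Vec Act n) → X₀ (n , v)

  -- Label of the i-th event of a cell.
  event : ∀ {n} → Cell n → Fin n → Act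
  event (v , _) = lookup v

  δ : ∀ {n} → Side → Fin (suc n) → Cell (suc n) → Cell n
  δ k i (v , x) = removeAt v i , X₁ (d k i v) x

record HDA (Act : Set a) : Set (lsuc a) where
  field
    precubical : PrecubicalSet Act
  open PrecubicalSet precubical public
  field
    initial : Cell 0

------------------------------------------------------------------------
-- Paths

module _ {Act : Set a} (H : HDA Act) where
  open HDA H

  -- Equations between cells compare the underlying conclists as well, so
  -- they also say that d_i^k goes between the conclists of the two cells.
  data Step : ∀ {m n} → Cell m → Cell n → Set a where
    up   : ∀ {n} {x : Cell n} {y : Cell (suc n)} (i : Fin (suc n)) →
           x ≡ δ 𝟎 i y → Step x y
    down : ∀ {n} {x : Cell (suc n)} {y : Cell n} (i : Fin (suc n)) →
           y ≡ δ 𝟏 i x → Step x y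

  infixl 5 _▷_

  data PathTo : ∀ {n} → Cell n → Set a where
    []  : PathTo initial
    _▷_ : ∀ {m n} {x : Cell m} {y : Cell n} → PathTo x → Step x y → PathTo y

  record Path : Set a where
    constructor path
    field
      {dimension} : ℕ
      {end}       : Cell dimension
      steps       : PathTo end

module _ {Act : Set a} {H : HDA Act} where
  open HDA H

  length : ∀ {n} {x : Cell n} → PathTo H x → ℕ
  length []      = 0
  length (α ▷ _) = suc (length α)

  data Prefix : ∀ {m n} {x : Cell m} {y : Cell n} → PathTo H x → PathTo H y → Set a where
    here  : ∀ {n} {x : Cell n} {α : PathTo H x} → Prefix α α
    there : ∀ {l m n} {x : Cell l} {y : Cell m} {z : Cell n}
            {α : PathTo H x} {β : PathTo H y} {s : Step H y z} →
            Prefix α β → Prefix α (β ▷ s)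

  -- Rules for replacing two consecutive steps, w → x → z by w → x′ → z.
  -- The pairs of indices i < j of the mathematical definition are here
  -- inject₁ i < suc j with i ≤ j, so that its j − 1 is here j; and its i is
  -- here i or inject₁ i according to the dimension of the cell involved.
  Rule : Set (lsuc a)
  Rule = ∀ {l m m′ n} {w : Cell l} {x : Cell m} {x′ : Cell m′} {z : Cell n} →
         Step H w x → Step H x z → Step H w x′ → Step H x′ z → Set a

  data Permute : Rule where
    up-up     : ∀ {n} {w : Cell n} {x x′ : Cell (suc n)} {z : Cell (suc (suc n))}
                {i j : Fin (suc n)} →
                i ≤ j →
                {p : w ≡ δ 𝟎 i x} {q : x ≡ δ 𝟎 (suc j) z}
                {p′ : w ≡ δ 𝟎 j x′} {q′ : x′ ≡ δ 𝟎 (inject₁ i) z} →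
                Permute (up i p) (up (suc j) q) (up j p′) (up (inject₁ i) q′)
    down-down : ∀ {n} {w : Cell (suc (suc n))} {x x′ : Cell (suc n)} {z : Cell n}
                {i j : Fin (suc n)} →
                i ≤ j →
                {p : x ≡ δ 𝟏 (suc j) w} {q : z ≡ δ 𝟏 i x}
                {p′ : x′ ≡ δ 𝟏 (inject₁ i) w} {q′ : z ≡ δ 𝟏 j x′} →
                Permute (down (suc j) p) (down i q) (down (inject₁ i) p′) (down j q′)

  data Sequentialize : Rule where
    first-up  : ∀ {n} {w z : Cell (suc n)} {x : Cell (suc (suc n))} {x′ : Cell n}
                {i j : Fin (suc n)} →
                i ≤ j →
                {p : w ≡ δ 𝟎 (inject₁ i) x} {q : z ≡ δ 𝟏 (suc j) x}
                {p′ : x′ ≡ δ 𝟏 j w} {q′ : x′ ≡ δ 𝟎 i z} →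
                Sequentialize (up (inject₁ i) p) (down (suc j) q) (down j p′) (up i q′)
    second-up : ∀ {n} {w z : Cell (suc n)} {x : Cell (suc (suc n))} {x′ : Cell n}
                {i j : Fin (suc n)} →
                i ≤ j →
                {p : w ≡ δ 𝟎 (suc j) x} {q : z ≡ δ 𝟏 (inject₁ i) x}
                {p′ : x′ ≡ δ 𝟏 i w} {q′ : x′ ≡ δ 𝟎 j z} →
                Sequentialize (up (suc j) p) (down (inject₁ i) q) (down i p′) (up j q′)

  -- Replace ρ α ℓ β : β is obtained from α by replacing, according to ρ, the
  -- two steps around the cell x_ℓ of α.
  data Replace (ρ : Rule) : ∀ {m n} {x : Cell m} {y : Cell n} →
                            PathTo H x → ℕ → PathTo H y → Set a where
    here  : ∀ {l m m′ n} {w : Cell l} {x : Cell m} {x′ : Cell m′} {z : Cell n}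
            {α : PathTo H w} {s : Step H w x} {t : Step H x z}
            {s′ : Step H w x′} {t′ : Step H x′ z} →
            ρ s t s′ t′ →
            Replace ρ (α ▷ s ▷ t) (suc (length α)) (α ▷ s′ ▷ t′)
    there : ∀ {m n} {x : Cell m} {y : Cell n} {α β : PathTo H x} {s : Step H x y} {ℓ} →
            Replace ρ α ℓ β → Replace ρ (α ▷ s) ℓ (β ▷ s)

  infix 4 _↪_ _⇆[_]_ _⊑[_]_

  _↪_ : Path H → Path H → Set a
  path α ↪ path β = Prefix α β

  _⇆[_]_ : Path H → ℕ → Path H → Set a
  path α ⇆[ ℓ ] path β = Replace Permute α ℓ β ⊎ Replace Permute β ℓ α

  -- β subsumes α.
  _⊑[_]_ : Path H → ℕ → Path H → Set a
  path α ⊑[ ℓ ] path β = Replace Sequentialize β ℓ α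

------------------------------------------------------------------------
-- ST-traces

data STLetter (Act : Set a) : Set a where
  _⁺  : Act → STLetter Act
  _^_ : Act → ℕ → STLetter Act

module _ {Act : Set a} {H : HDA Act} where
  open HDA H

  -- start α c is the starting position of a down-step with index c that
  -- extends α.  Moving that step to the left changes no step before it, so
  -- only its index has to be tracked.  Past a down-step with index e, c
  -- becomes c if c < e and c + 1 if c ≥ e; past an up-step with index e ≢ c,
  -- it becomes c if c < e and c − 1 if c > e.  See start-sound and
  -- start-unique below.
  start : ∀ {n} {x : Cell n} → PathTo H x → Fin n → ℕ
  start (α ▷ down e _) c = start α (punchIn e c)
  start (α ▷ up e _)   c with e ≟ c
  ... | yes _   = suc (length α)
  ... | no  e≢c = start α (punchOut e≢c)

  ST-to : ∀ {n} {x : Cell n} → PathTo H x → List (STLetter Act)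
  ST-to []                         = []
  ST-to (_▷_ {y = y} α (up i _))   = ST-to α ∷ʳ (event y i ⁺)
  ST-to (_▷_ {x = x} α (down i _)) = ST-to α ∷ʳ (event x i ^ start α i)

  ST : Path H → List (STLetter Act)
  ST (path α) = ST-to α

IsSTTrace : {Act : Set a} → List (STLetter Act) → Set (lsuc a)
IsSTTrace {Act = Act} m = ∃ λ (H : HDA Act) → ∃ λ (α : Path H) → ST α ≡ m

-- The characterization of start by moving a down-step to the left through
-- actual replacements in the path.

data Order {n} : Fin (suc (suc n)) → Fin (suc n) → Set where
  above : ∀ {i j} → i ≤ j → Order (suc j) i
  below : ∀ {i j} → i ≤ j → Order (inject₁ i) j

order : ∀ {n} (e : Fin (suc (suc n))) (c : Fin (suc n)) → Order e c
order zero    c    = below {i = zero} z≤n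
order (suc e) zero = above z≤n
order {suc n} (suc e) (suc c) with order e c
... | above i≤j = above (s≤s i≤j)
... | below i≤j = below (s≤s i≤j)

punchIn-above : ∀ {n} {i j : Fin (suc n)} → i ≤ j → punchIn (suc j) i ≡ inject₁ i
punchIn-above {i = zero}                       _         = refl
punchIn-above {n = suc n} {i = suc i} {j = suc j} (s≤s i≤j) = cong suc (punchIn-above i≤j)

punchIn-below : ∀ {n} {i j : Fin (suc n)} → i ≤ j → punchIn (inject₁ i) j ≡ suc j
punchIn-below {i = zero}                       _         = refl
punchIn-below {n = suc n} {i = suc i} {j = suc j} (s≤s i≤j) = cong suc (punchIn-below i≤j)

punchIn-punchIn : ∀ {n} {i j : Fin (suc n)} → i ≤ j → (t : Fin n) →
                  punchIn (suc j) (punchIn i t) ≡ punchIn (inject₁ i) (punchIn j t)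
punchIn-punchIn {i = zero}              _         t       = refl
punchIn-punchIn {i = suc i} {j = suc j} (s≤s i≤j) zero    = refl
punchIn-punchIn {i = suc i} {j = suc j} (s≤s i≤j) (suc t) = cong suc (punchIn-punchIn i≤j t)

removeAt-suc : ∀ {A : Set a} {n} x (v : Vec A (suc n)) i →
               removeAt (x ∷ v) (suc i) ≡ x ∷ removeAt v i
removeAt-suc x (_ ∷ _) i = refl

removeAt-removeAt : ∀ {A : Set a} {n} (v : Vec A (suc (suc n))) {i j : Fin (suc n)} → i ≤ j →
                    removeAt (removeAt v (suc j)) i ≡ removeAt (removeAt v (inject₁ i)) j
removeAt-removeAt (x ∷ y ∷ v)     {zero}          _         = refl
removeAt-removeAt (x ∷ y ∷ z ∷ v) {suc i} {suc j} (s≤s i≤j) =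
  trans (cong (x ∷_) (removeAt-removeAt (y ∷ z ∷ v) i≤j))
        (sym (removeAt-suc x (removeAt (y ∷ z ∷ v) (inject₁ i)) j))

cofaceValue-self : ∀ {n} k (i : Fin n) → cofaceValue k i i ≡ at k
cofaceValue-self k i with i ≟ i
... | yes _  = refl
... | no i≢i = contradiction refl i≢i

cofaceValue-other : ∀ {n} k {i u : Fin n} → u ≢ i → cofaceValue k i u ≡ ✱
cofaceValue-other k {i} {u} u≢i with u ≟ i
... | yes u≡i = contradiction u≡i u≢i
... | no _    = refl

composeValue-image : ∀ {m n} (g : Fin m → Fin n) → Injective _≡_ _≡_ g → ∀ ζ ε t →
                     composeValue g ζ ε (g t) ≡ ε t
composeValue-image g g-inj ζ ε t with any? (λ s → g s ≟ g t)
... | yes (s , gs≡gt) = cong ε (g-inj gs≡gt)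
... | no ∄s           = contradiction (t , refl) ∄s

composeValue-∉ : ∀ {m n} (g : Fin m → Fin n) ζ ε u → (∀ t → g t ≢ u) →
                 composeValue g ζ ε u ≡ ζ u
composeValue-∉ g ζ ε u u∉ with any? (λ s → g s ≟ u)
... | yes (s , gs≡u) = contradiction gs≡u (u∉ s)
... | no _           = refl

-- Value at punchIn i t of a composite of two coface maps.
compose-in : ∀ {n} k l (i : Fin (suc n)) (j : Fin n) t →
             composeValue (punchIn i) (cofaceValue k i) (cofaceValue l j) (punchIn i t)
             ≡ cofaceValue l j t
compose-in k l i j t = composeValue-image (punchIn i) (punchIn-injective i _ _) _ _ t

compose-self : ∀ {n} k l (i : Fin (suc n)) (j : Fin n) →
               composeValue (punchIn i) (cofaceValue k i) (cofaceValue l j) i ≡ at k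
compose-self k l i j =
  trans (composeValue-∉ (punchIn i) _ _ i (punchInᵢ≢i i)) (cofaceValue-self k i)

compose-cofaces : ∀ {n} k l {i j : Fin (suc n)} → i ≤ j → ∀ u →
  composeValue (punchIn (suc j)) (cofaceValue l (suc j)) (cofaceValue k i) u
  ≡ composeValue (punchIn (inject₁ i)) (cofaceValue k (inject₁ i)) (cofaceValue l j) u
compose-cofaces k l {i} {j} i≤j u with u ≟ suc j
... | yes refl =
      trans (compose-self l k (suc j) i)
            (sym (subst (λ v → rhs v ≡ at l) (punchIn-below i≤j)
                        (trans (compose-in k l (inject₁ i) j j) (cofaceValue-self l j))))
  where
  rhs = composeValue (punchIn (inject₁ i)) (cofaceValue k (inject₁ i)) (cofaceValue l j)
... | no u≢j = subst (λ v → lhs v ≡ rhs v) (punchIn-punchOut (u≢j ∘ sym)) (other (punchOut (u≢j ∘ sym)))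
  where
  lhs = composeValue (punchIn (suc j)) (cofaceValue l (suc j)) (cofaceValue k i)
  rhs = composeValue (punchIn (inject₁ i)) (cofaceValue k (inject₁ i)) (cofaceValue l j)

  other : ∀ t → lhs (punchIn (suc j) t) ≡ rhs (punchIn (suc j) t)
  other t with t ≟ i
  ... | yes refl =
        trans (compose-in l k (suc j) i i)
        (trans (cofaceValue-self k i)
               (sym (trans (cong rhs (punchIn-above i≤j)) (compose-self k l (inject₁ i) j))))
  ... | no t≢i =
        trans (compose-in l k (suc j) i t)
        (trans (cofaceValue-other k t≢i)
               (sym (trans (cong rhs (trans (cong (punchIn (suc j)) (sym it′≡t)) (punchIn-punchIn i≤j t′)))
                    (trans (compose-in k l (inject₁ i) j (punchIn j t′))
                           (cofaceValue-other l (punchInᵢ≢i j t′))))))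
    where
    t′ = punchOut (t≢i ∘ sym)

    it′≡t : punchIn i t′ ≡ t
    it′≡t = punchIn-punchOut (t≢i ∘ sym)

module _ {Act : Set a} (X : PrecubicalSet Act) where
  open PrecubicalSet X

  X₁-cong : ∀ {n} {W : Conclist Act} {v v′ : Vec Act n} → v ≡ v′ →
            (φ : Hom (n , v) W) (ψ : Hom (n , v′) W) →
            (∀ t → Hom.f φ t ≡ Hom.f ψ t) → (∀ u → Hom.ε φ u ≡ Hom.ε ψ u) →
            (x : X₀ W) → _≡_ {A = Cell n} (v , X₁ φ x) (v′ , X₁ ψ x)
  X₁-cong refl φ ψ f-≗ ε-≗ x = cong (_ ,_) (X-resp (f-≗ , ε-≗) x)

  δ-δ : ∀ {n} k l {i j : Fin (suc n)} → i ≤ j → (x : Cell (suc (suc n))) →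
        δ k i (δ l (suc j) x) ≡ δ l j (δ k (inject₁ i) x)
  δ-δ k l {i} {j} i≤j (v , x) =
    trans (cong (_ ,_) (sym (X-∘ (d l (suc j) v) (d k i _) x)))
    (trans (X₁-cong (removeAt-removeAt v i≤j) (d l (suc j) v ∘□ d k i _)
                    (d k (inject₁ i) v ∘□ d l j _)
                    (punchIn-punchIn i≤j) (compose-cofaces k l i≤j) x)
           (cong (_ ,_) (X-∘ (d k (inject₁ i) v) (d l j _) x)))

module _ {Act : Set a} {H : HDA Act} where
  open HDA H

  -- StartsAt α k : moving the last step of α, a down-step, to the left
  -- stops directly after the k-th step.
  data StartsAt : ∀ {n} {x : Cell n} → PathTo H x → ℕ → Set a where
    stop      : ∀ {n} {w z : Cell n} {x : Cell (suc n)} {α : PathTo H w} {i : Fin (suc n)}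
                {p : w ≡ δ 𝟎 i x} {q : z ≡ δ 𝟏 i x} →
                StartsAt (α ▷ up i p ▷ down i q) (suc (length α))
    past-down : ∀ {n} {w : Cell (suc (suc n))} {x x′ : Cell (suc n)} {z : Cell n}
                {α : PathTo H w} {e c′ : Fin (suc (suc n))} {c e′ : Fin (suc n)} {k}
                {p : x ≡ δ 𝟏 e w} {q : z ≡ δ 𝟏 c x} {p′ : x′ ≡ δ 𝟏 c′ w} {q′ : z ≡ δ 𝟏 e′ x′} →
                Permute {H = H} (down e p) (down c q) (down c′ p′) (down e′ q′)
                  ⊎ Permute {H = H} (down c′ p′) (down e′ q′) (down e p) (down c q) →
                StartsAt (α ▷ down c′ p′) k →
                StartsAt (α ▷ down e p ▷ down c q) k
    past-up   : ∀ {n} {w z : Cell (suc n)} {x : Cell (suc (suc n))} {x′ : Cell n}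
                {α : PathTo H w} {e c : Fin (suc (suc n))} {c′ e′ : Fin (suc n)} {k}
                {p : w ≡ δ 𝟎 e x} {q : z ≡ δ 𝟏 c x} {p′ : x′ ≡ δ 𝟏 c′ w} {q′ : x′ ≡ δ 𝟎 e′ z} →
                Sequentialize {H = H} (up e p) (down c q) (down c′ p′) (up e′ q′) →
                StartsAt (α ▷ down c′ p′) k →
                StartsAt (α ▷ up e p ▷ down c q) k

  start-sound : ∀ {n} {x : Cell (suc n)} {y : Cell n} (α : PathTo H x) (c : Fin (suc n))
                (q : y ≡ δ 𝟏 c x) → StartsAt (α ▷ down c q) (start α c)
  start-sound (α ▷ down e refl) c refl with order e c
  ... | above {i} {j} i≤j = past-down
        (inj₁ (down-down i≤j {p′ = refl} {q′ = δ-δ precubical 𝟏 𝟏 i≤j _}))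
        (subst (λ c′ → StartsAt (α ▷ down (inject₁ i) refl) (start α c′))
               (sym (punchIn-above i≤j)) (start-sound α (inject₁ i) refl))
  ... | below {i} {j} i≤j = past-down
        (inj₂ (down-down i≤j {p = refl} {q = sym (δ-δ precubical 𝟏 𝟏 i≤j _)}))
        (subst (λ c′ → StartsAt (α ▷ down (suc j) refl) (start α c′))
               (sym (punchIn-below i≤j)) (start-sound α (suc j) refl))
  start-sound (α ▷ up e refl) c refl with e ≟ c
  ... | yes refl = stop
  start-sound {zero}  (α ▷ up zero refl) zero refl | no 0≢0 = contradiction refl 0≢0
  start-sound {suc n} (α ▷ up e refl) c refl | no e≢c =
    move (punchOut e≢c) (punchIn-punchOut e≢c)
    where
    move : ∀ c′ → punchIn e c′ ≡ c → StartsAt (α ▷ up e refl ▷ down c refl) (start α c′)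
    move c′ refl with order e c′
    ... | above i≤j rewrite punchIn-above i≤j =
          past-up (second-up i≤j {p′ = refl} {q′ = δ-δ precubical 𝟏 𝟎 i≤j _}) (start-sound α c′ refl)
    ... | below i≤j rewrite punchIn-below i≤j =
          past-up (first-up i≤j {p′ = refl} {q′ = sym (δ-δ precubical 𝟎 𝟏 i≤j _)}) (start-sound α c′ refl)

  start-unique : ∀ {n} {x : Cell (suc n)} {y : Cell n} {α : PathTo H x} {c : Fin (suc n)}
                 {q : y ≡ δ 𝟏 c x} {k} → StartsAt (α ▷ down c q) k → k ≡ start α c
  start-unique (stop {i = i}) with i ≟ i
  ... | yes _  = refl
  ... | no i≢i = contradiction refl i≢i
  start-unique (past-down {α = α} (inj₁ (down-down i≤j)) S) =
    trans (start-unique S) (cong (start α) (sym (punchIn-above i≤j)))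
  start-unique (past-down {α = α} (inj₂ (down-down i≤j)) S) =
    trans (start-unique S) (cong (start α) (sym (punchIn-below i≤j)))
  start-unique (past-up {α = α} (first-up {i = i} {j = j} i≤j) S) with inject₁ i ≟ suc j
  ... | yes eq = contradiction (trans (punchIn-below i≤j) (sym eq)) (punchInᵢ≢i (inject₁ i) j)
  ... | no neq = trans (start-unique S) (cong (start α)
          (punchIn-injective (inject₁ i) _ _ (trans (punchIn-below i≤j) (sym (punchIn-punchOut neq)))))
  start-unique (past-up {α = α} (second-up {i = i} {j = j} i≤j) S) with suc j ≟ inject₁ i
  ... | yes eq = contradiction (trans (punchIn-above i≤j) (sym eq)) (punchInᵢ≢i (suc j) i)
  ... | no neq = trans (start-unique S) (cong (start α)
          (punchIn-injective (suc j) _ _ (trans (punchIn-above i≤j) (sym (punchIn-punchOut neq)))))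

------------------------------------------------------------------------
-- Bisimulations

data Symbol : Set where
  ⊑ ⊒ ⇆ ↩ : Symbol

-- The clauses in one direction; "with the roles exchanged" is flip.
record IsSimulation {Act : Set a} (I : Pred Symbol 0ℓ) {Y Z : HDA Act}
                    (R : REL (Path Y) (Path Z) a) : Set a where
  field
    initial-related : R (path []) (path [])
    same-ST         : ∀ {α β} → R α β → ST α ≡ ST β
    sim-↪           : ∀ {α β α′} → R α β → α ↪ α′ →
                      ∃[ β′ ] (β ↪ β′ × R α′ β′)
    sim-⊑           : ⊑ ∈ I → ∀ {α β α′ ℓ} → R α β → α ⊑[ ℓ ] α′ →
                      ∃[ β′ ] (β ⊑[ ℓ ] β′ × R α′ β′)
    sim-⊒           : ⊒ ∈ I → ∀ {α β α′ ℓ} → R α β → α′ ⊑[ ℓ ] α →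
                      ∃[ β′ ] (β′ ⊑[ ℓ ] β × R α′ β′)
    sim-⇆           : ⇆ ∈ I → ∀ {α β α′ ℓ} → R α β → α′ ⇆[ ℓ ] α →
                      ∃[ β′ ] (β′ ⇆[ ℓ ] β × R α′ β′)
    sim-↩           : ↩ ∈ I → ∀ {α β α′} → R α β → α′ ↪ α →
                      ∃[ β′ ] (β′ ↪ β × R α′ β′)

IsBisimulation : {Act : Set a} (I : Pred Symbol 0ℓ) {Y Z : HDA Act} →
                 REL (Path Y) (Path Z) a → Set a
IsBisimulation I {Y} {Z} R =
  IsSimulation I {Y} {Z} R × IsSimulation I {Z} {Y} (flip R)

Bisimilar : {Act : Set a} → Pred Symbol 0ℓ → HDA Act → HDA Act → Set (lsuc a)
Bisimilar {a = a} I Y Z =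
  ∃ λ (R : REL (Path Y) (Path Z) a) → IsBisimulation I {Y} {Z} R

HHPBisimilar : {Act : Set a} → HDA Act → HDA Act → Set (lsuc a)
HHPBisimilar = Bisimilar U

------------------------------------------------------------------------
-- Logic

data Formula (Act : Set a) (I : Pred Symbol 0ℓ) : Set (lsuc a) where
  true : Formula Act I
  neg  : Formula Act I → Formula Act I
  ⋀    : (J : Set a) → (J → Formula Act I) → Formula Act I
  Λ    : (m : List (STLetter Act)) → IsSTTrace m → Formula Act I
  ⟨↪⟩  : Formula Act I → Formula Act I
  ⟨⊑⟩  : ⊑ ∈ I → ℕ → Formula Act I → Formula Act I
  ⟨⊒⟩  : ⊒ ∈ I → ℕ → Formula Act I → Formula Act I
  ⟨⇆⟩  : ⇆ ∈ I → ℕ → Formula Act I → Formula Act I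
  ⟨↩⟩  : ↩ ∈ I → Formula Act I → Formula Act I

infix 4 _⊨_ _⊨ᴴ_

_⊨_ : {Act : Set a} {I : Pred Symbol 0ℓ} {H : HDA Act} → Path H → Formula Act I → Set a
α ⊨ true      = ⊤
α ⊨ neg F     = ¬ (α ⊨ F)
α ⊨ ⋀ J F     = ∀ (j : J) → α ⊨ F j
α ⊨ Λ m _     = ST α ≡ m
α ⊨ ⟨↪⟩ F     = ∃[ β ] (α ↪ β × β ⊨ F)
α ⊨ ⟨⊑⟩ _ ℓ F = ∃[ β ] (α ⊑[ ℓ ] β × β ⊨ F)
α ⊨ ⟨⊒⟩ _ ℓ F = ∃[ β ] (β ⊑[ ℓ ] α × β ⊨ F)
α ⊨ ⟨⇆⟩ _ ℓ F = ∃[ β ] (α ⇆[ ℓ ] β × β ⊨ F)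
α ⊨ ⟨↩⟩ _ F   = ∃[ β ] (β ↪ α × β ⊨ F)

_⊨ᴴ_ : {Act : Set a} {I : Pred Symbol 0ℓ} → HDA Act → Formula Act I → Set a
H ⊨ᴴ F = _⊨_ {H = H} (path []) F

SameFormulas : {Act : Set a} → Pred Symbol 0ℓ → HDA Act → HDA Act → Set (lsuc a)
SameFormulas {Act = Act} I Y Z = ∀ (F : Formula Act I) → (Y ⊨ᴴ F) ⇔ (Z ⊨ᴴ F)

{-# OPTIONS --safe #-}

-- Preservation is by induction on formulas.  Conversely, logical equivalence
-- is itself a bisimulation: if no successor β′ of β satisfies the same
-- formulas as the successor α′ of α, choose for each β′ a formula true at α′
-- and false at β′; the conjunction of all of them is possible after α but not
-- after β.  Logical equivalence quantifies over the large type of formulas, so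
-- excluded middle is also used to replace it by a truth value at level a.

module Submission where

open import Level using (Level; Lift; lift; lower; suc; 0ℓ)
open import Axiom.ExcludedMiddle using (ExcludedMiddle)
open import Axiom.DoubleNegationElimination using (DoubleNegationElimination; em⇒dne)
open import Data.Product using (∃; ∃-syntax; _×_; _,_; proj₁; proj₂; swap)
import Data.Sum as Sum
open import Function using (_∘_; flip; _⇔_; mk⇔; Equivalence)
open import Relation.Binary using (REL)
open import Relation.Binary.PropositionalEquality using (refl; sym)
open import Relation.Nullary using (¬_)
open import Relation.Nullary.Decidable using (True; map′; toWitness; fromWitness)
open import Relation.Unary using (Pred; U)
open import Defs

private
  variable
    a : Level
    Act : Set a
    Y Z : HDA Act

-- One implication is enough: under a negation the roles are exchanged, and `swap b` makes `flip R`
-- a bisimulation from `Z` to `Y`.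
bisimulation-preserves : ∀ {Act : Set a} {I : Pred Symbol 0ℓ} {Y Z : HDA Act}
  {R : REL (Path Y) (Path Z) a} → IsBisimulation I R →
  (F : Formula Act I) → ∀ {α β} → R α β → α ⊨ F → β ⊨ F
bisimulation-preserves b true    r _ = _
bisimulation-preserves b (neg F) r α⊭F = α⊭F ∘ bisimulation-preserves (swap b) F r
bisimulation-preserves b (⋀ J F) r α⊨F j = bisimulation-preserves b (F j) r (α⊨F j)
bisimulation-preserves b (Λ m _) r refl = sym (IsSimulation.same-ST (proj₁ b) r)
bisimulation-preserves b (⟨↪⟩ F) {α} {β} r (α′ , s , α′⊨F) =
  let β′ , t , r′ = IsSimulation.sim-↪ (proj₁ b) {α} {β} {α′} r s
  in  β′ , t , bisimulation-preserves b F r′ α′⊨F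
bisimulation-preserves b (⟨⊑⟩ p ℓ F) {α} {β} r (α′ , s , α′⊨F) =
  let β′ , t , r′ = IsSimulation.sim-⊑ (proj₁ b) p {α} {β} {α′} r s
  in  β′ , t , bisimulation-preserves b F r′ α′⊨F
bisimulation-preserves b (⟨⊒⟩ p ℓ F) {α} {β} r (α′ , s , α′⊨F) =
  let β′ , t , r′ = IsSimulation.sim-⊒ (proj₁ b) p {α} {β} {α′} r s
  in  β′ , t , bisimulation-preserves b F r′ α′⊨F
bisimulation-preserves b (⟨⇆⟩ p ℓ F) {α} {β} r (α′ , s , α′⊨F) =
  -- The clause and the modality write similarity in opposite directions; exchanging the two
  -- disjuncts turns one into the other.
  let β′ , t , r′ = IsSimulation.sim-⇆ (proj₁ b) p {α} {β} {α′} r (Sum.swap s)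
  in  β′ , Sum.swap t , bisimulation-preserves b F r′ α′⊨F
bisimulation-preserves b (⟨↩⟩ p F) {α} {β} r (α′ , s , α′⊨F) =
  let β′ , t , r′ = IsSimulation.sim-↩ (proj₁ b) p {α} {β} {α′} r s
  in  β′ , t , bisimulation-preserves b F r′ α′⊨F

bisimilar⇒sameFormulas : ∀ {I} → Bisimilar I Y Z → SameFormulas I Y Z
bisimilar⇒sameFormulas (R , b) F =
  mk⇔ (bisimulation-preserves b F (IsSimulation.initial-related (proj₁ b)))
      (bisimulation-preserves (swap b) F (IsSimulation.initial-related (proj₁ b)))

module _ (em : ExcludedMiddle (suc a)) {Act : Set a} (I : Pred Symbol 0ℓ) where

  private
    dne⁺ : DoubleNegationElimination (suc a)
    dne⁺ = em⇒dne em

    dne : DoubleNegationElimination a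
    -- Small propositions are decided by lifting them to level `suc a`.
    dne = em⇒dne (map′ lower lift em)

  infix 4 _≼_

  _≼_ : {Y Z : HDA Act} → Path Y → Path Z → Set (suc a)
  α ≼ β = ∀ (F : Formula Act I) → α ⊨ F → β ⊨ F

  -- Closure under `neg` makes this one-sided inclusion of theories an equivalence.
  ≼-sym : {Y Z : HDA Act} {α : Path Y} {β : Path Z} → α ≼ β → β ≼ α
  ≼-sym α≼β F β⊨F = dne λ α⊭F → α≼β (neg F) α⊭F β⊨F

  distinguish : {Y Z : HDA Act} {α : Path Y} {β : Path Z} → ¬ (α ≼ β) →
                ∃[ F ] (α ⊨ F × ¬ (β ⊨ F))
  distinguish α⋠β = dne⁺ λ ∄F → α⋠β λ F α⊨F → dne λ β⊭F → ∄F (F , α⊨F , β⊭F)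

  -- Used with `T` the successors of one state and `α` a successor of a related one. As `∃ T` lives
  -- at level `a`, it can index a conjunction. `R` stands in for `≼`, which is too large for a
  -- bisimulation.
  match : {Y Z : HDA Act} (α : Path Y) (T : Pred (Path Z) a) (R : REL (Path Y) (Path Z) a) →
          (∀ {β} → α ≼ β → R α β) →
          (∀ F → α ⊨ F → ∃[ β ] (T β × β ⊨ F)) →
          ∃[ β ] (T β × R α β)
  match α T R ≼⇒R transfer = dne λ unmatched →
    let witness : (j : ∃ T) → ∃[ F ] (α ⊨ F × ¬ (proj₁ j ⊨ F))
        witness (β , t) = distinguish λ α≼β → unmatched (β , t , ≼⇒R α≼β)
        -- The `β` obtained here satisfies every conjunct, including the one chosen to fail at `β`
        -- itself.
        β , t , β⊨ = transfer (⋀ (∃ T) (proj₁ ∘ witness)) (proj₁ ∘ proj₂ ∘ witness)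
    in  proj₂ (proj₂ (witness (β , t))) (β⊨ (β , t))

  ≼-simulation : {Y Z : HDA Act} (R : REL (Path Y) (Path Z) a) →
                 (∀ {α β} → R α β ⇔ α ≼ β) →
                 _≼_ {Y} {Z} (path []) (path []) →
                 IsSimulation I R
  ≼-simulation {Y} {Z} R R⇔≼ initial≼ = record
    { initial-related = from initial≼
    -- `α` itself witnesses that `ST α` is an ST-trace.
    ; same-ST         = λ {α} r → sym (to r (Λ (ST α) (Y , α , refl)) refl)
    ; sim-↪           = λ {α} {β} {α′} r s →
        match α′ (β ↪_) R from λ F α′⊨F → to r (⟨↪⟩ F) (α′ , s , α′⊨F)
    ; sim-⊑           = λ p {α} {β} {α′} {ℓ} r s →
        match α′ (β ⊑[ ℓ ]_) R from λ F α′⊨F → to r (⟨⊑⟩ p ℓ F) (α′ , s , α′⊨F)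
    ; sim-⊒           = λ p {α} {β} {α′} {ℓ} r s →
        match α′ (_⊑[ ℓ ] β) R from λ F α′⊨F → to r (⟨⊒⟩ p ℓ F) (α′ , s , α′⊨F)
    ; sim-⇆           = λ p {α} {β} {α′} {ℓ} r s →
        match α′ (_⇆[ ℓ ] β) R from λ F α′⊨F →
          let β′ , t , β′⊨F = to r (⟨⇆⟩ p ℓ F) (α′ , Sum.swap s , α′⊨F)
          in  β′ , Sum.swap t , β′⊨F
    ; sim-↩           = λ p {α} {β} {α′} r s →
        match α′ (_↪ β) R from λ F α′⊨F → to r (⟨↩⟩ p F) (α′ , s , α′⊨F)
    }
    where
    to : ∀ {α β} → R α β → α ≼ β
    to {α} {β} = Equivalence.to (R⇔≼ {α} {β})

    from : ∀ {α β} → α ≼ β → R α β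
    from {α} {β} = Equivalence.from (R⇔≼ {α} {β})

  sameFormulas⇒bisimilar : {Y Z : HDA Act} → SameFormulas I Y Z → Bisimilar I Y Z
  sameFormulas⇒bisimilar {Y} {Z} same =
    R , ≼-simulation R (mk⇔ to from) initial≼
      , ≼-simulation (flip R) (mk⇔ (≼-sym ∘ to) (from ∘ ≼-sym)) (≼-sym initial≼)
    where
    R : REL (Path Y) (Path Z) a
    -- `True` keeps only the outcome of the decision, a type at level 0, which is then lifted to
    -- `a`.
    R α β = Lift a (True (em {P = α ≼ β}))

    to : ∀ {α β} → R α β → α ≼ β
    to = toWitness ∘ lower

    from : ∀ {α β} → α ≼ β → R α β
    from = lift ∘ fromWitness

    initial≼ : _≼_ {Y} {Z} (path []) (path [])
    initial≼ F = Equivalence.to (same F)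

mainTheorem1 : ∀ {a} → ExcludedMiddle (suc a) → {Act : Set a} →
    (∀ (I : Pred Symbol 0ℓ) (Y Z : HDA Act) → Bisimilar I Y Z ⇔ SameFormulas I Y Z)
    × (∀ (Y Z : HDA Act) → HHPBisimilar Y Z ⇔ SameFormulas U Y Z)
mainTheorem1 em = characterization , characterization U
  where
  characterization : ∀ I Y Z → Bisimilar I Y Z ⇔ SameFormulas I Y Z
  characterization I _ _ = mk⇔ bisimilar⇒sameFormulas (sameFormulas⇒bisimilar em I)
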